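{- Let $C_k$ be a cycle on $k\ge 5$ vertices with any edge-ordering. Then $sat_m(n,C_k)=\Theta(n)$.
   Context: An edge-ordered graph is a finite simple graph together with a linear order on its edge set (usually given by an injective labeling $l:E\to\mathbb{N}$ or $l:E\to\mathbb{R}$). An edge-ordered graph $H$ contains $G$ (has a copy of $G$) if $G$ is isomorphic, by an isomorphism respecting the edge-order, to a subgraph of $H$ with the induced order; otherwise $H$ is $G$-free. $sat_m(n,G)$ is the minimum number of edges in a $G$-free edge-ordered graph $H$ on $n$ vertices such that adding to $H$ any missing edge, inserted at the beginning of the linear order (i.e. with a label smaller than all labels of $H$), creates a copy of $G$. Asymptotic notation is for $n\to\infty$ with the edge-ordered graph $G$ fixed. -}

module Defs where

open import Data.Nat using (ℕ; suc; _*_; _≤_)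
open import Data.Fin using (Fin; toℕ)
open import Data.List using (List; _∷_; length; map)
open import Data.List.Relation.Unary.All using (All; _∷_)
open import Data.List.Relation.Unary.All.Properties using (¬Any⇒All¬)
open import Data.List.Relation.Unary.AllPairs using (AllPairs; _∷_)
open import Data.List.Relation.Unary.Any using (Any)
open import Data.List.Relation.Binary.Sublist.Heterogeneous using (Sublist)
open import Data.Product using (_×_; _,_; ∃-syntax; Σ-syntax)
open import Data.Sum using (_⊎_)
open import Function.Bundles using (_⇔_)
open import Function.Definitions using (Injective)
open import Relation.Binary.PropositionalEquality using (_≡_; _≢_)
open import Relation.Nullary using (¬_)

Pair : ℕ → Set
Pair n = Fin n × Fin n

-- Equality of the unordered pairs {u,v} and {x,y}.
infix 4 _≈ₑ_
_≈ₑ_ : ∀ {n} → Pair n → Pair n → Set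
(u , v) ≈ₑ (x , y) = (u ≡ x × v ≡ y) ⊎ (u ≡ y × v ≡ x)

-- The vertex set is Fin n.  The list enumerates the edge set, without
-- repetition, in increasing order; each edge {u,v} is listed once, as either
-- (u , v) or (v , u).
record EdgeOrderedGraph (n : ℕ) : Set where
  field
    edges    : List (Pair n)
    loopless : All (λ (u , v) → u ≢ v) edges
    simple   : AllPairs (λ e e′ → ¬ e ≈ₑ e′) edges

open EdgeOrderedGraph public

Adj : ∀ {n} → EdgeOrderedGraph n → Fin n → Fin n → Set
Adj H u v = Any ((u , v) ≈ₑ_) (edges H)

∣E_∣ : ∀ {n} → EdgeOrderedGraph n → ℕ
∣E H ∣ = length (edges H)

addFirst : ∀ {n} (H : EdgeOrderedGraph n) (u v : Fin n) →
           u ≢ v → ¬ Adj H u v → EdgeOrderedGraph n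
addFirst H u v u≢v uv∉H = record
  { edges    = (u , v) ∷ edges H
  ; loopless = u≢v ∷ loopless H
  ; simple   = ¬Any⇒All¬ (edges H) uv∉H ∷ simple H
  }

-- A subgraph of H with the induced edge-order is a sublist of edges H, so f
-- is an order-respecting isomorphism onto such a subgraph exactly when it is
-- injective and the images of the edges of G, in the order of G, form a
-- sublist of edges H.
Contains : ∀ {k n} → EdgeOrderedGraph n → EdgeOrderedGraph k → Set
Contains {k} {n} H G =
  Σ[ f ∈ (Fin k → Fin n) ]
    Injective _≡_ _≡_ f ×
    Sublist _≈ₑ_ (map (λ (u , v) → f u , f v) (edges G)) (edges H)

Free : ∀ {k n} → EdgeOrderedGraph k → EdgeOrderedGraph n → Set
Free G H = ¬ Contains H G

Saturatedₘ : ∀ {k n} → EdgeOrderedGraph k → EdgeOrderedGraph n → Set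
Saturatedₘ G H =
  Free G H ×
  (∀ u v (u≢v : u ≢ v) (uv∉H : ¬ Adj H u v) → Contains (addFirst H u v u≢v uv∉H) G)

-- s = sat_m(n, G)
IsSatₘ : ∀ {k} → ℕ → EdgeOrderedGraph k → ℕ → Set
IsSatₘ n G s =
  (∃[ H ] Saturatedₘ {n = n} G H × ∣E H ∣ ≡ s) ×
  (∀ (H : EdgeOrderedGraph n) → Saturatedₘ G H → s ≤ ∣E H ∣)

-- The cyclic successor on {0, …, k − 1}.
Next : ∀ {k} → Fin k → Fin k → Set
Next {k} i j = (toℕ j ≡ suc (toℕ i)) ⊎ (suc (toℕ i) ≡ k × toℕ j ≡ 0)

-- The underlying graph is the cycle 0, 1, …, k − 1, 0; the edge-order is
-- unconstrained.  This is the k-cycle for k ≥ 3.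
IsCycle : ∀ {k} → EdgeOrderedGraph k → Set
IsCycle C = ∀ i j → Adj C i j ⇔ (Next i j ⊎ Next j i)

-- f = Θ(g).  Constants are naturals: a lower constant c > 0 can be replaced by
-- some 1/a ≤ c, and an upper one by a larger natural number.
infix 4 _=Θ_
_=Θ_ : (ℕ → ℕ) → (ℕ → ℕ) → Set
f =Θ g = ∃[ a ] ∃[ b ] ∃[ n₀ ] (∀ n → n₀ ≤ n → g n ≤ a * f n × f n ≤ b * g n)

{-# OPTIONS --safe #-}
module Submission where

-- In a saturated graph every vertex u has positive degree: otherwise a new edge uv could not lie on
-- a cycle.  Hence n ≤ 2 |E|.
--
-- For the upper bound let ab be the first edge of C.  Delete it, and merge a and b into one vertex,
-- blown up to an independent set I of size n − k + 2, keeping the edges that replace one edge of C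
-- consecutive.  Adding an edge between two vertices of I, before all others, gives a copy of C in
-- which the new edge plays the role of ab.  The graph itself has no k-cycle: only k − 2 vertices
-- lie outside I, so two vertices of the cycle lie in I; all vertices of I have the same two
-- neighbours, so these two would form a 4-cycle with their neighbours.  Complete this graph
-- greedily, inserting edges at the beginning: no two vertices of I are ever joined, so all edges of
-- the result meet a set of fewer than k vertices.

open import Data.Empty using (⊥; ⊥-elim)
open import Data.Fin using (Fin; zero; suc; toℕ; fromℕ<; _↑ˡ_; _↑ʳ_; splitAt; punchOut)
open import Data.Fin.Properties
  using (_≟_; any?; all?; injective⇒≤; pigeonhole; punchOut-injective; toℕ-injective;
         toℕ<n; toℕ-fromℕ<; ↑ʳ-injective; splitAt-↑ˡ; splitAt-↑ʳ; splitAt⁻¹-↑ˡ;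
         splitAt⁻¹-↑ʳ; <⇒≢)
open import Data.List
  using (List; []; _∷_; _++_; [_]; length; map; concat; filter; allFin; cartesianProduct)
import Data.List as List
open import Data.List.Membership.Propositional using (_∈_; find)
open import Data.List.Membership.Propositional.Properties
  using (∈-lookup; ∈-allFin; ∈-cartesianProduct⁺; ∈-filter⁺; ∈-map⁺; ∈-++⁺ˡ; ∈-++⁺ʳ)
open import Data.List.Membership.Setoid.Properties using (index-injective)
open import Data.List.Properties
  using (length-++; length-map; length-tabulate; map-cong; map-∘; ++-assoc)
open import Data.List.Relation.Binary.Sublist.Heterogeneous
  using (Sublist; []; _∷_; _∷ʳ_; fromAny) renaming (lookup to ⊑-lookup)
import Data.List.Relation.Binary.Sublist.Heterogeneous.Properties as ⊑
open import Data.List.Relation.Unary.All as All using (All; []; _∷_)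
import Data.List.Relation.Unary.All.Properties as All
open import Data.List.Relation.Unary.AllPairs as AllPairs using (AllPairs; []; _∷_; allPairs?)
import Data.List.Relation.Unary.AllPairs.Properties as AllPairs
open import Data.List.Relation.Unary.Any as Any using (Any; here; there)
import Data.List.Relation.Unary.Any.Properties as Any
open import Data.List.Relation.Unary.Unique.Propositional using (Unique)
import Data.List.Relation.Unary.Unique.Propositional.Properties as Unique
open import Data.Nat as ℕ using (ℕ; zero; suc; _+_; _*_; _≤_; _<_; z≤n; s≤s)
import Data.Nat.Properties as ℕ
open import Data.Product using (Σ-syntax; ∃; ∃-syntax; _×_; _,_; proj₁; proj₂)
open import Data.Sum using (_⊎_; inj₁; inj₂; [_,_]′)
import Data.Sum as Sum
open import Data.Vec using (Vec; []; _∷_; lookup; tabulate; toList; fromList)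
open import Data.Vec.Properties using (lookup∘tabulate; length-toList; toList∘fromList)
open import Function using (_∘_; id; const)
open import Function.Bundles using (Equivalence)
open import Function.Definitions using (Injective)
open import Relation.Binary.PropositionalEquality
  using (_≡_; _≢_; refl; sym; trans; cong; cong₂; subst; ≢-sym; setoid; module ≡-Reasoning)
open import Relation.Nullary using (¬_; Dec; yes; no; contradiction)
open import Relation.Nullary.Decidable using (map′; _×-dec_; _⊎-dec_; _→-dec_; ¬?; decidable-stable)
open import Relation.Unary using (Decidable)
open import Defs

-- Lists

lookup-injective : ∀ {A : Set} {xs : List A} → Unique xs → ∀ i j →
                   List.lookup xs i ≡ List.lookup xs j → i ≡ j
lookup-injective {xs = _ ∷ _} _         zero    zero    _  = refl
lookup-injective {xs = _ ∷ _} (x∉ ∷ _)  zero    (suc j) eq =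
  contradiction eq (All.lookup x∉ (∈-lookup j))
lookup-injective {xs = _ ∷ _} (x∉ ∷ _)  (suc i) zero    eq =
  contradiction (sym eq) (All.lookup x∉ (∈-lookup i))
lookup-injective {xs = _ ∷ _} (_ ∷ xs!) (suc i) (suc j) eq =
  cong suc (lookup-injective xs! i j eq)

-- Each position in `xs` goes to the position in `ys` where the same entry is found; as `xs` has no
-- repetition, this map is injective. All edge counts below rest on this.
Unique-⊆⇒length≤ : ∀ {A : Set} {xs ys : List A} → Unique xs →
                   (∀ {x} → x ∈ xs → x ∈ ys) → length xs ≤ length ys
Unique-⊆⇒length≤ {A} {xs} {ys} xs! xs⊆ys = injective⇒≤ {f = position} λ {i} {j} eq →
  lookup-injective xs! i j
    (index-injective (setoid A) (xs⊆ys (∈-lookup i)) (xs⊆ys (∈-lookup j)) eq)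
  where
  position : Fin (length xs) → Fin (length ys)
  position i = Any.index (xs⊆ys (∈-lookup i))

length-cartesianProduct : ∀ {A B : Set} (xs : List A) (ys : List B) →
                          length (cartesianProduct xs ys) ≡ length xs * length ys
length-cartesianProduct []       ys = refl
length-cartesianProduct (x ∷ xs) ys =
  trans (length-++ (map (x ,_) ys))
        (cong₂ _+_ (length-map (x ,_) ys) (length-cartesianProduct xs ys))

AllPairs-mapWith : ∀ {A : Set} {P : A → Set} {R S : A → A → Set} →
                   (∀ {x y} → P x → P y → R x y → S x y) →
                   ∀ {xs} → All P xs → AllPairs R xs → AllPairs S xs
AllPairs-mapWith f []         []         = []
AllPairs-mapWith f (px ∷ pxs) (rx ∷ rxs) =
  All.zipWith (λ (py , rxy) → f px py rxy) (pxs , rx) ∷ AllPairs-mapWith f pxs rxs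

-- Unordered pairs

≈ₑ-refl : ∀ {n} {e : Pair n} → e ≈ₑ e
≈ₑ-refl = inj₁ (refl , refl)

≈ₑ-sym : ∀ {n} {e e′ : Pair n} → e ≈ₑ e′ → e′ ≈ₑ e
≈ₑ-sym (inj₁ (refl , refl)) = inj₁ (refl , refl)
≈ₑ-sym (inj₂ (refl , refl)) = inj₂ (refl , refl)

≈ₑ-trans : ∀ {n} {e e′ e″ : Pair n} → e ≈ₑ e′ → e′ ≈ₑ e″ → e ≈ₑ e″
≈ₑ-trans (inj₁ (refl , refl)) q                    = q
≈ₑ-trans (inj₂ (refl , refl)) (inj₁ (refl , refl)) = inj₂ (refl , refl)
≈ₑ-trans (inj₂ (refl , refl)) (inj₂ (refl , refl)) = inj₁ (refl , refl)

≈ₑ-swap : ∀ {n} {u v : Fin n} {e : Pair n} → (u , v) ≈ₑ e → (v , u) ≈ₑ e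
≈ₑ-swap = ≈ₑ-trans (inj₂ (refl , refl))

infix 8 _⟨$⟩_
_⟨$⟩_ : ∀ {k n} → (Fin k → Fin n) → Pair k → Pair n
f ⟨$⟩ (u , v) = f u , f v

≈ₑ-cong : ∀ {k n} (f : Fin k → Fin n) {e e′ : Pair k} → e ≈ₑ e′ → f ⟨$⟩ e ≈ₑ f ⟨$⟩ e′
≈ₑ-cong f (inj₁ (refl , refl)) = inj₁ (refl , refl)
≈ₑ-cong f (inj₂ (refl , refl)) = inj₂ (refl , refl)

_≈ₑ?_ : ∀ {n} (e e′ : Pair n) → Dec (e ≈ₑ e′)
(u , v) ≈ₑ? (x , y) = (u ≟ x ×-dec v ≟ y) ⊎-dec (u ≟ y ×-dec v ≟ x)

≈ₑ-loopless : ∀ {n} {u v x y : Fin n} → x ≢ y → (u , v) ≈ₑ (x , y) → u ≢ v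
≈ₑ-loopless x≢y (inj₁ (refl , refl)) = x≢y
≈ₑ-loopless x≢y (inj₂ (refl , refl)) = ≢-sym x≢y

Adj⇒≢ : ∀ {n} (H : EdgeOrderedGraph n) {u v} → Adj H u v → u ≢ v
Adj⇒≢ H uv with x≢y , uv≈xy ← All.lookupAny (loopless H) uv = ≈ₑ-loopless x≢y uv≈xy

∈⇒Adj : ∀ {n} (H : EdgeOrderedGraph n) {u v} → (u , v) ∈ edges H → Adj H u v
∈⇒Adj H = Any.map λ { refl → ≈ₑ-refl }

edges-unique : ∀ {n} (H : EdgeOrderedGraph n) → Unique (edges H)
edges-unique H = AllPairs.map (λ { e≉e refl → e≉e ≈ₑ-refl }) (simple H)

allPairs : ∀ n → List (Pair n)
allPairs n = cartesianProduct (allFin n) (allFin n)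

∈-allPairs : ∀ {n} (e : Pair n) → e ∈ allPairs n
∈-allPairs (u , v) = ∈-cartesianProduct⁺ (∈-allFin u) (∈-allFin v)

length-allFin : ∀ n → length (allFin n) ≡ n
length-allFin n = length-tabulate id

-- A crude bound by the number of ordered pairs; it makes the greedy completion terminate.
∣E∣≤n² : ∀ {n} (H : EdgeOrderedGraph n) → ∣E H ∣ ≤ n * n
∣E∣≤n² {n} H = subst (∣E H ∣ ≤_)
  (trans (length-cartesianProduct (allFin n) (allFin n))
         (cong₂ _*_ (length-allFin n) (length-allFin n)))
  (Unique-⊆⇒length≤ (edges-unique H) (λ {e} _ → ∈-allPairs e))

-- Copies in an ordered list of edges

infix 4 _⊑_
_⊑_ : ∀ {n} → List (Pair n) → List (Pair n) → Set
_⊑_ = Sublist _≈ₑ_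

⊑-refl : ∀ {n} {es : List (Pair n)} → es ⊑ es
⊑-refl = ⊑.refl ≈ₑ-refl

-- Unfolds to the same type as `Contains`, but for a bare list, so that a copy in `(u , v) ∷ es` can
-- be discussed before the list is known to be a graph.
Embeds : ∀ {k n} → List (Pair n) → EdgeOrderedGraph k → Set
Embeds {k} {n} es G = Σ[ f ∈ (Fin k → Fin n) ] Injective _≡_ _≡_ f × map (f ⟨$⟩_) (edges G) ⊑ es

Embeds-mono : ∀ {k n} {G : EdgeOrderedGraph k} {es es′ : List (Pair n)} →
              es ⊑ es′ → Embeds es G → Embeds es′ G
Embeds-mono es⊑es′ (f , f-inj , G⊑es) = f , f-inj , ⊑.trans ≈ₑ-trans G⊑es es⊑es′

Any-⊑ : ∀ {n} {e : Pair n} {es es′ : List (Pair n)} → es ⊑ es′ → Any (e ≈ₑ_) es → Any (e ≈ₑ_) es′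
Any-⊑ = ⊑-lookup (λ e′≈e″ e≈e′ → ≈ₑ-trans e≈e′ e′≈e″)

Any-image : ∀ {k n} {f : Fin k → Fin n} {gs : List (Pair k)} {es : List (Pair n)} {e : Pair k} →
            map (f ⟨$⟩_) gs ⊑ es → Any (e ≈ₑ_) gs → Any (f ⟨$⟩ e ≈ₑ_) es
Any-image {f = f} fgs⊑es e∈gs = Any-⊑ fgs⊑es (Any.map⁺ (Any.map (≈ₑ-cong f) e∈gs))

-- Decidability by exhaustive search

-- Finiteness in a form that passes from `A` to vectors over `A`, so that both vertex maps and edge
-- lists of a given length can be searched.
Searchable : Set → Set₁
Searchable A = ∀ {P : A → Set} → Decidable P → Dec (∃ P)

Searchable-Pair : ∀ {n} → Searchable (Pair n)
Searchable-Pair P? = map′ (λ (u , v , p) → (u , v) , p) (λ ((u , v) , p) → u , v , p)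
                          (any? λ u → any? λ v → P? (u , v))

Searchable-Vec : ∀ {A : Set} → Searchable A → ∀ m → Searchable (Vec A m)
Searchable-Vec search zero    P? = map′ ([] ,_) (λ { ([] , p) → p }) (P? [])
Searchable-Vec search (suc m) P? =
  map′ (λ (x , xs , p) → x ∷ xs , p) (λ { (x ∷ xs , p) → x , xs , p })
       (search λ x → Searchable-Vec search m λ xs → P? (x ∷ xs))

injective? : ∀ {k n} (f : Fin k → Fin n) → Dec (Injective _≡_ _≡_ f)
injective? f = map′ (λ inj {i} {j} → inj i j) (λ inj i j → inj)
                    (all? λ i → all? λ j → (f i ≟ f j) →-dec (i ≟ j))

-- Vertex maps are searched as vectors. Since `lookup (tabulate f)` agrees with `f` only pointwise,
-- the image of the edge list is transported by `map-cong`.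
embeds? : ∀ {k n} (es : List (Pair n)) (G : EdgeOrderedGraph k) → Dec (Embeds es G)
embeds? {k} es G = map′
  (λ (xs , p) → lookup xs , p)
  (λ (f , f-inj , G⊑es) → tabulate f
    , (λ {i} {j} eq → f-inj (trans (sym (lookup∘tabulate f i)) (trans eq (lookup∘tabulate f j))))
    , subst (_⊑ es)
        (map-cong (λ (u , v) → sym (cong₂ _,_ (lookup∘tabulate f u) (lookup∘tabulate f v))) (edges G))
        G⊑es)
  (Searchable-Vec any? k λ xs →
    injective? (lookup xs) ×-dec ⊑.sublist? _≈ₑ?_ (map (lookup xs ⟨$⟩_) (edges G)) es)

CreatesCopies : ∀ {k n} → List (Pair n) → EdgeOrderedGraph k → Set
CreatesCopies es G = ∀ u v → u ≢ v → ¬ Any ((u , v) ≈ₑ_) es → Embeds ((u , v) ∷ es) G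

adj? : ∀ {n} (es : List (Pair n)) u v → Dec (Any ((u , v) ≈ₑ_) es)
adj? es u v = Any.any? ((u , v) ≈ₑ?_) es

createsCopies? : ∀ {k n} (es : List (Pair n)) (G : EdgeOrderedGraph k) → Dec (CreatesCopies es G)
createsCopies? es G = all? λ u → all? λ v →
  ¬? (u ≟ v) →-dec (¬? (adj? es u v) →-dec embeds? ((u , v) ∷ es) G)

saturated-of-size? : ∀ {k} n (G : EdgeOrderedGraph k) s →
                     Dec (∃[ H ] Saturatedₘ {n = n} G H × ∣E H ∣ ≡ s)
saturated-of-size? n G s = map′ to from (Searchable-Vec Searchable-Pair s λ xs → valid? (toList xs))
  where
  Valid : List (Pair n) → Set
  Valid es = All (λ (u , v) → u ≢ v) es × AllPairs (λ e e′ → ¬ e ≈ₑ e′) es ×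
             ¬ Embeds es G × CreatesCopies es G

  valid? : Decidable Valid
  valid? es = All.all? (λ (u , v) → ¬? (u ≟ v)) es ×-dec allPairs? (λ e e′ → ¬? (e ≈ₑ? e′)) es ×-dec
              ¬? (embeds? es G) ×-dec createsCopies? es G

  to : ∃[ xs ] Valid (toList {n = s} xs) → ∃[ H ] Saturatedₘ {n = n} G H × ∣E H ∣ ≡ s
  to (xs , loopless-xs , simple-xs , saturated) =
    record { edges = toList xs ; loopless = loopless-xs ; simple = simple-xs } ,
    saturated , length-toList xs

  from : ∃[ H ] Saturatedₘ {n = n} G H × ∣E H ∣ ≡ s → ∃[ xs ] Valid (toList {n = s} xs)
  from (H , saturated , refl) =
    fromList (edges H) ,
    subst Valid (sym (toList∘fromList (edges H))) (loopless H , simple H , saturated)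

-- Recursion on the known witness `m`: if zero fails, shifting the predicate by one lowers the
-- witness.
least : ∀ {P : ℕ → Set} → Decidable P → ∀ {m} → P m → ∃[ s ] P s × (∀ t → P t → s ≤ t)
least P? {zero}  p = zero , p , λ _ _ → z≤n
least P? {suc m} p with P? zero
... | yes p₀ = zero , p₀ , λ _ _ → z≤n
... | no ¬p₀ with s , pₛ , minimal ← least (P? ∘ suc) {m} p =
  suc s , pₛ , λ { zero p₀ → contradiction p₀ ¬p₀ ; (suc t) pₜ → s≤s (minimal t pₜ) }

-- Greedy completion

-- A pair is inserted only if the result stays free of `G`. Each insertion trades one unit of fuel
-- for one edge, so fuel that has run out means at least `n * n` edges, and one more would exceed
-- `∣E∣≤n²`. The new edges are recorded as a prefix of the list.
complete : ∀ {k n} (G : EdgeOrderedGraph k) fuel (H : EdgeOrderedGraph n) → Free G H →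
           n * n ≤ fuel + ∣E H ∣ → ∃[ H′ ] Saturatedₘ G H′ × (∃[ new ] edges H′ ≡ new ++ edges H)
complete {n = n} G fuel H free bound
  with any? (λ u → any? (λ v →
         ¬? (u ≟ v) ×-dec ¬? (adj? (edges H) u v) ×-dec ¬? (embeds? ((u , v) ∷ edges H) G)))
complete G fuel H free bound | no stuck =
  H , (free , λ u v u≢v uv∉H → decidable-stable (embeds? ((u , v) ∷ edges H) G)
                                 λ ¬copy → stuck (u , v , u≢v , uv∉H , ¬copy)) , [] , refl
complete G zero H free bound | yes (u , v , u≢v , uv∉H , ¬copy) =
  contradiction (ℕ.≤-trans (∣E∣≤n² (addFirst H u v u≢v uv∉H)) bound) ℕ.1+n≰n
complete {n = n} G (suc fuel) H free bound | yes (u , v , u≢v , uv∉H , ¬copy)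
  with H′ , saturated , new , eq ← complete G fuel (addFirst H u v u≢v uv∉H) ¬copy
                                     (subst (n * n ≤_) (sym (ℕ.+-suc fuel ∣E H ∣)) bound) =
  H′ , saturated , new ++ [ u , v ] , trans eq (sym (++-assoc new [ u , v ] (edges H)))

completion : ∀ {k n} (G : EdgeOrderedGraph k) (H : EdgeOrderedGraph n) → Free G H →
             ∃[ H′ ] Saturatedₘ G H′ × (∃[ new ] edges H′ ≡ new ++ edges H)
completion {n = n} G H free = complete G (n * n) H free (ℕ.m≤m+n (n * n) ∣E H ∣)

-- If the pair occurred in `H′`, it would have been inserted in front of all edges of `H`. Then
-- `(u , v) ∷ edges H` would be a sublist of `edges H′`, and the copy would survive in `H′`.
completion-skips : ∀ {k n} {G : EdgeOrderedGraph k} (H H′ : EdgeOrderedGraph n) {new : List (Pair n)} →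
                   Free G H′ → edges H′ ≡ new ++ edges H → ∀ {u v} →
                   ¬ Adj H u v → Embeds ((u , v) ∷ edges H) G → ¬ Adj H′ u v
completion-skips {G = G} H H′ {new} free eq {u} {v} uv∉H copy uv∈H′
  with Any.++⁻ new (subst (Any ((u , v) ≈ₑ_)) eq uv∈H′)
... | inj₂ uv∈H   = uv∉H uv∈H
... | inj₁ uv∈new = free (Embeds-mono {G = G}
      (subst ((u , v) ∷ edges H ⊑_) (sym eq) (⊑.++⁺ (fromAny uv∈new) ⊑-refl)) copy)

-- Blow-ups

module _ {k n : ℕ} (r : Fin n → Fin k) where

  block : Pair k → List (Pair n)
  block (c , d) = filter (λ (s , t) → (r s ≟ c) ×-dec (r t ≟ d)) (allPairs n)

  block-image : ∀ e → All (λ e′ → r ⟨$⟩ e′ ≡ e) (block e)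
  block-image (c , d) = All.map (λ (rs≡c , rt≡d) → cong₂ _,_ rs≡c rt≡d)
                                (All.all-filter (λ (s , t) → (r s ≟ c) ×-dec (r t ≟ d)) (allPairs n))

  ∈-block : ∀ e → e ∈ block (r ⟨$⟩ e)
  ∈-block e@(u , v) =
    ∈-filter⁺ (λ (s , t) → (r s ≟ r u) ×-dec (r t ≟ r v)) (∈-allPairs e) (refl , refl)

  -- The block lists distinct ordered pairs. If one were the reverse of another, a single vertex
  -- would lie in the classes of both ends of `e`.
  block-simple : ∀ {e} → proj₁ e ≢ proj₂ e → AllPairs (λ e′ e″ → ¬ e′ ≈ₑ e″) (block e)
  block-simple {c , d} c≢d = AllPairs-mapWith distinct (block-image (c , d))
    (AllPairs.filter⁺ _ (Unique.cartesianProduct⁺ (Unique.allFin⁺ n) (Unique.allFin⁺ n)))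
    where
    distinct : ∀ {e′ e″} → r ⟨$⟩ e′ ≡ (c , d) → r ⟨$⟩ e″ ≡ (c , d) → e′ ≢ e″ → ¬ e′ ≈ₑ e″
    distinct _    _    e′≢e″ (inj₁ (refl , refl)) = e′≢e″ refl
    distinct refl re″≡ _     (inj₂ (refl , refl)) = c≢d (sym (cong proj₁ re″≡))

  -- Vertex c becomes the independent set of all s with r s ≡ c; the edges replacing one edge of Q
  -- are consecutive in the order.
  blowUp : EdgeOrderedGraph k → EdgeOrderedGraph n
  blowUp Q = record
    { edges    = concat (map block (edges Q))
    ; loopless = All.concat⁺ (All.map⁺ (All.map
        (λ {e} c≢d → All.map (λ { refl → c≢d ∘ cong r }) (block-image e)) (loopless Q)))
    ; simple   = AllPairs.concat⁺
        (All.map⁺ (All.map block-simple (loopless Q)))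
        (AllPairs.map⁺ (AllPairs.map
          (λ {e} {e′} e≉e′ → All.map
            (λ { refl → All.map (λ { refl → e≉e′ ∘ ≈ₑ-cong r }) (block-image e′) }) (block-image e))
          (simple Q)))
    }

  -- This makes `r` a graph homomorphism from the blow-up to `Q`: all pairs in a block project to
  -- the edge that the block replaces.
  Adj-blowUp⁻ : ∀ Q {s t} → Adj (blowUp Q) s t → Adj Q (r s) (r t)
  Adj-blowUp⁻ Q st =
    Any.map (λ {e} st∈ → project e st∈) (Any.map⁻ (Any.concat⁻ (map block (edges Q)) st))
    where
    project : ∀ e {s t} → Any ((s , t) ≈ₑ_) (block e) → (r s , r t) ≈ₑ e
    project e st∈ with re′≡e , st≈e′ ← All.lookupAny (block-image e) st∈ =
      subst (_ ≈ₑ_) re′≡e (≈ₑ-cong r st≈e′)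

  -- Each edge lies in the block of its own image, so picking one edge from each successive block
  -- recovers `es` in its order.
  ⊑-blowUp : ∀ (es : List (Pair n)) → es ⊑ concat (map block (map (r ⟨$⟩_) es))
  ⊑-blowUp []       = []
  ⊑-blowUp (e ∷ es) =
    ⊑.++⁺ (fromAny (Any.map (λ { refl → ≈ₑ-refl }) (∈-block e))) (⊑-blowUp es)

-- The cyclic successor

module CyclicOrder {k : ℕ} (5≤k : 5 ≤ k) where

  -- A data type rather than a synonym for Next, so that i and j can be inferred.
  infix 4 _⟶_
  data _⟶_ (i j : Fin k) : Set where
    arc : Next i j → i ⟶ j

  Link : Fin k → Fin k → Set
  Link i j = i ⟶ j ⊎ j ⟶ i

  -- j is reached from i by m arcs, w of which lead from k − 1 to 0.
  data Steps (m : ℕ) (i j : Fin k) : Set where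
    wrap : ∀ w → toℕ j + w * k ≡ m + toℕ i → Steps m i j

  ⟶⇒Steps : ∀ {i j} → i ⟶ j → Steps 1 i j
  ⟶⇒Steps (arc (inj₁ j≡1+i)) = wrap 0 (trans (ℕ.+-identityʳ _) j≡1+i)
  ⟶⇒Steps (arc (inj₂ (1+i≡k , j≡0))) =
    wrap 1 (trans (cong (_+ 1 * k) j≡0) (trans (ℕ.*-identityˡ k) (sym 1+i≡k)))

  Steps-trans : ∀ {m m′ i j l} → Steps m i j → Steps m′ j l → Steps (m′ + m) i l
  Steps-trans {m} {m′} {i} {j} {l} (wrap w p) (wrap w′ p′) = wrap (w′ + w) (begin
    toℕ l + (w′ + w) * k     ≡⟨ cong (toℕ l +_) (ℕ.*-distribʳ-+ k w′ w) ⟩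
    toℕ l + (w′ * k + w * k) ≡⟨ ℕ.+-assoc (toℕ l) (w′ * k) (w * k) ⟨
    toℕ l + w′ * k + w * k   ≡⟨ cong (_+ w * k) p′ ⟩
    m′ + toℕ j + w * k       ≡⟨ ℕ.+-assoc m′ (toℕ j) (w * k) ⟩
    m′ + (toℕ j + w * k)     ≡⟨ cong (m′ +_) p ⟩
    m′ + (m + toℕ i)         ≡⟨ ℕ.+-assoc m′ m (toℕ i) ⟨
    m′ + m + toℕ i           ∎)
    where open ≡-Reasoning

  -- Cancelling `toℕ i` leaves `w * k ≡ m`, and no multiple of `k` lies strictly between 0 and 5,
  -- because `5 ≤ k`.
  Steps-aperiodic : ∀ {m i} → 0 < m → m < 5 → ¬ Steps m i i
  Steps-aperiodic {m} {i} 0<m m<5 (wrap w p) = multiple w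
    (ℕ.+-cancelʳ-≡ (toℕ i) (w * k) m (trans (ℕ.+-comm (w * k) (toℕ i)) p))
    where
    multiple : ∀ w → w * k ≢ m
    multiple zero    0≡m  = ℕ.<⇒≢ 0<m 0≡m
    multiple (suc w) wk≡m = ℕ.<⇒≱ (ℕ.≤-trans m<5 5≤k) (subst (k ≤_) wk≡m (ℕ.m≤m+n k (w * k)))

  no-loop : ∀ {i} → ¬ i ⟶ i
  no-loop ii = Steps-aperiodic (s≤s z≤n) (s≤s (s≤s z≤n)) (⟶⇒Steps ii)

  no-2-cycle : ∀ {i j} → i ⟶ j → ¬ j ⟶ i
  no-2-cycle ij ji =
    Steps-aperiodic (s≤s z≤n) (s≤s (s≤s (s≤s z≤n))) (Steps-trans (⟶⇒Steps ij) (⟶⇒Steps ji))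

  no-3-cycle : ∀ {i j l} → i ⟶ j → j ⟶ l → ¬ l ⟶ i
  no-3-cycle ij jl li = Steps-aperiodic (s≤s z≤n) (s≤s (s≤s (s≤s (s≤s z≤n))))
    (Steps-trans (Steps-trans (⟶⇒Steps ij) (⟶⇒Steps jl)) (⟶⇒Steps li))

  no-4-cycle : ∀ {h i j l} → h ⟶ i → i ⟶ j → j ⟶ l → ¬ l ⟶ h
  no-4-cycle hi ij jl lh = Steps-aperiodic (s≤s z≤n) (s≤s (s≤s (s≤s (s≤s (s≤s z≤n)))))
    (Steps-trans (Steps-trans (Steps-trans (⟶⇒Steps hi) (⟶⇒Steps ij)) (⟶⇒Steps jl))
                 (⟶⇒Steps lh))

  ⟶-functional : ∀ {i j j′} → i ⟶ j → i ⟶ j′ → j ≡ j′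
  ⟶-functional (arc (inj₁ p)) (arc (inj₁ p′)) = toℕ-injective (trans p (sym p′))
  ⟶-functional {j = j} (arc (inj₁ p)) (arc (inj₂ (q , _))) =
    contradiction (trans p q) (ℕ.<⇒≢ (toℕ<n j))
  ⟶-functional {j′ = j′} (arc (inj₂ (q , _))) (arc (inj₁ p)) =
    contradiction (trans p q) (ℕ.<⇒≢ (toℕ<n j′))
  ⟶-functional (arc (inj₂ (_ , p))) (arc (inj₂ (_ , p′))) = toℕ-injective (trans p (sym p′))

  ⟶-injective : ∀ {i i′ j} → i ⟶ j → i′ ⟶ j → i ≡ i′
  ⟶-injective (arc (inj₁ p)) (arc (inj₁ p′)) =
    toℕ-injective (ℕ.suc-injective (trans (sym p) p′))
  ⟶-injective (arc (inj₁ p)) (arc (inj₂ (_ , p′))) = contradiction (trans (sym p′) p) λ ()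
  ⟶-injective (arc (inj₂ (_ , p))) (arc (inj₁ p′)) = contradiction (trans (sym p) p′) λ ()
  ⟶-injective (arc (inj₂ (p , _))) (arc (inj₂ (p′ , _))) =
    toℕ-injective (ℕ.suc-injective (trans p (sym p′)))

  successor : ∀ i → ∃[ j ] i ⟶ j
  successor i with suc (toℕ i) ℕ.<? k
  ... | yes 1+i<k = fromℕ< 1+i<k , arc (inj₁ (toℕ-fromℕ< 1+i<k))
  ... | no  1+i≮k = fromℕ< 0<k , arc (inj₂ (ℕ.≤-antisym (toℕ<n i) (ℕ.≮⇒≥ 1+i≮k) , toℕ-fromℕ< 0<k))
    where
    0<k : 0 < k
    0<k = ℕ.≤-trans (s≤s z≤n) 5≤k

  predecessor : ∀ j → ∃[ i ] i ⟶ j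
  predecessor j with toℕ j in eq
  ... | suc i = fromℕ< i<k , arc (inj₁ (trans eq (cong suc (sym (toℕ-fromℕ< i<k)))))
    where
    i<k : i < k
    i<k = ℕ.<-trans (ℕ.n<1+n i) (subst (_< k) eq (toℕ<n j))
  ... | zero = fromℕ< pred<k , arc (inj₂ (trans (cong suc (toℕ-fromℕ< pred<k)) 1+pred≡k , eq))
    where
    1+pred≡k : suc (ℕ.pred k) ≡ k
    1+pred≡k = ℕ.suc-pred k {{ℕ.>-nonZero (ℕ.≤-trans (s≤s z≤n) 5≤k)}}

    pred<k : ℕ.pred k < k
    pred<k = ℕ.≤-reflexive 1+pred≡k

  Link-sym : ∀ {i j} → Link i j → Link j i
  Link-sym = Sum.swap

  Link⇒≢ : ∀ {i j} → Link i j → i ≢ j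
  Link⇒≢ (inj₁ ii) refl = no-loop ii
  Link⇒≢ (inj₂ ii) refl = no-loop ii

  -- Two links through `j` in opposite directions have equal ends; in the same direction, the third
  -- link closes a directed 3-cycle or forces a loop.
  triangle-free : ∀ {i j l} → Link i j → Link j l → ¬ Link i l
  triangle-free (inj₁ ij) (inj₁ jl) (inj₁ il) = no-loop (subst (_ ⟶_) (⟶-functional il ij) jl)
  triangle-free (inj₁ ij) (inj₁ jl) (inj₂ li) = no-3-cycle ij jl li
  triangle-free (inj₁ ij) (inj₂ lj) il        = Link⇒≢ il (⟶-injective ij lj)
  triangle-free (inj₂ ji) (inj₁ jl) il        = Link⇒≢ il (⟶-functional ji jl)
  triangle-free (inj₂ ji) (inj₂ lj) (inj₁ il) = no-3-cycle il lj ji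
  triangle-free (inj₂ ji) (inj₂ lj) (inj₂ li) = no-loop (subst (_ ⟶_) (⟶-functional li lj) ji)

  -- The neighbours of `i` are its successor and its predecessor, which differ because there is no
  -- directed 2-cycle; `o` is the one that is not `j`.
  other-neighbour : ∀ {i j} → Link i j →
                    ∃[ o ] Link i o × o ≢ j × (∀ v → Link i v → v ≢ j → v ≡ o)
  other-neighbour {i} (inj₁ ij) with o , oi ← predecessor i =
    o , inj₂ oi , (λ { refl → no-2-cycle ij oi }) , λ
      { v (inj₁ iv) v≢j → contradiction (⟶-functional iv ij) v≢j
      ; v (inj₂ vi) v≢j → ⟶-injective vi oi }
  other-neighbour {i} (inj₂ ji) with o , io ← successor i =
    o , inj₁ io , (λ { refl → no-2-cycle ji io }) , λ
      { v (inj₁ iv) v≢j → ⟶-functional iv io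
      ; v (inj₂ vi) v≢j → contradiction (⟶-injective vi ji) v≢j }

  Around : Fin k → Fin k → Fin k → Set
  Around i j p = Link i p ⊎ Link j p

  -- Two distinct vertices cannot have the same two neighbours, as that would be a 4-cycle.
  no-common-neighbourhood :
    ∀ {i j} (h : Fin k → Fin k) (x y : Fin k) → i ≢ j →
    (∀ {p} → Around i j p → h p ≡ x ⊎ h p ≡ y) →
    (∀ {p p′} → Around i j p → Around i j p′ → h p ≡ h p′ → p ≡ p′) → ⊥
  no-common-neighbourhood {i} {j} h x y i≢j two-valued inj
    with p , i⟶p ← successor i | o , o⟶i ← predecessor i
       | p′ , j⟶p′ ← successor j | o′ , o′⟶j ← predecessor j =
    absurd (third (inj₁ (inj₁ i⟶p)) (inj₁ (inj₂ o⟶i)) (inj₂ (inj₁ j⟶p′)) p≢o)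
           (third (inj₁ (inj₁ i⟶p)) (inj₁ (inj₂ o⟶i)) (inj₂ (inj₂ o′⟶j)) p≢o)
    where
    p≢o : p ≢ o
    p≢o refl = no-2-cycle i⟶p o⟶i

    -- By injectivity, `p` and `o` take both values `x` and `y`, so a further vertex around `i` or
    -- `j` must coincide with one of them.
    third : ∀ {p o q} → Around i j p → Around i j o → Around i j q → p ≢ o → q ≡ p ⊎ q ≡ o
    third P O Q p≢o with two-valued P | two-valued O | two-valued Q
    ... | inj₁ hp | inj₁ ho | _       = contradiction (inj P O (trans hp (sym ho))) p≢o
    ... | inj₂ hp | inj₂ ho | _       = contradiction (inj P O (trans hp (sym ho))) p≢o
    ... | inj₁ hp | inj₂ ho | inj₁ hq = inj₁ (inj Q P (trans hq (sym hp)))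
    ... | inj₁ hp | inj₂ ho | inj₂ hq = inj₂ (inj Q O (trans hq (sym ho)))
    ... | inj₂ hp | inj₁ ho | inj₂ hq = inj₁ (inj Q P (trans hq (sym hp)))
    ... | inj₂ hp | inj₁ ho | inj₁ hq = inj₂ (inj Q O (trans hq (sym ho)))

    -- Distinct vertices have distinct successors and distinct predecessors, so `p′` is `o` and `o′`
    -- is `p`; then `i`, `p`, `j`, `o` form a directed 4-cycle.
    absurd : p′ ≡ p ⊎ p′ ≡ o → o′ ≡ p ⊎ o′ ≡ o → ⊥
    absurd (inj₁ refl) _           = i≢j (⟶-injective i⟶p j⟶p′)
    absurd (inj₂ refl) (inj₂ refl) = i≢j (⟶-functional o⟶i o′⟶j)
    absurd (inj₂ refl) (inj₁ refl) = no-4-cycle i⟶p o′⟶j j⟶p′ o⟶i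

-- Punching out the missed value `b` leaves fewer values than arguments, so the pigeonhole principle
-- applies.
collision : ∀ {k} (h : Fin k → Fin k) b → (∀ i → h i ≢ b) → ∃[ i ] ∃[ j ] i ≢ j × h i ≡ h j
collision {suc k} h b avoids
  with i , j , i<j , eq ← pigeonhole (ℕ.n<1+n k) (λ i → punchOut (≢-sym (avoids i))) =
  i , j , <⇒≢ i<j , punchOut-injective (≢-sym (avoids i)) (≢-sym (avoids j)) eq

-- The cycle and its first edge

module Cycle {k : ℕ} (5≤k : 5 ≤ k) (C : EdgeOrderedGraph k) (isCycle : IsCycle C)
             {a b : Fin k} {rest : List (Pair k)} (first : edges C ≡ (a , b) ∷ rest) where

  open CyclicOrder 5≤k

  Link⇒Adj : ∀ {u v} → Link u v → Adj C u v
  Link⇒Adj {u} {v} = Equivalence.from (isCycle u v) ∘ Sum.map (λ { (arc p) → p }) (λ { (arc p) → p })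

  Adj⇒Link : ∀ {u v} → Adj C u v → Link u v
  Adj⇒Link {u} {v} = Sum.map arc arc ∘ Equivalence.to (isCycle u v)

  ab : Link a b
  ab = Adj⇒Link (subst (Any _) (sym first) (here ≈ₑ-refl))

  -- Membership in `rest`, up to orientation: as `ab` comes first, the edges of `C` other than `ab`
  -- are those after it.
  Later : Pair k → Set
  Later (u , v) = Link u v × ¬ (a , b) ≈ₑ (u , v)

  Later-swap : ∀ {u v} → Later (u , v) → Later (v , u)
  Later-swap (uv , ab≉uv) = Link-sym uv , λ ab≈vu → ab≉uv (≈ₑ-sym (≈ₑ-swap (≈ₑ-sym ab≈vu)))

  rest-simple : AllPairs (λ e e′ → ¬ e ≈ₑ e′) ((a , b) ∷ rest)
  rest-simple = subst (AllPairs _) first (simple C)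

  rest-later : All Later rest
  rest-later = All.zip
    ( All.tabulate (λ {(u , v)} e∈rest → Adj⇒Link (∈⇒Adj C (subst (_ ∈_) (sym first) (there e∈rest))))
    , AllPairs.head rest-simple )

  later∈rest : ∀ {e} → Later e → Any (e ≈ₑ_) rest
  later∈rest (uv , ab≉uv) with subst (Any _) first (Link⇒Adj uv)
  ... | here uv≈ab = contradiction (≈ₑ-sym uv≈ab) ab≉uv
  ... | there e∈   = e∈

  -- The lower bound

  neighbour-of-a : ∃[ x ] Later (a , x)
  neighbour-of-a with x , ax , x≢b , _ ← other-neighbour ab =
    x , ax , λ { (inj₁ (_ , b≡x)) → x≢b (sym b≡x) ; (inj₂ (_ , b≡a)) → Link⇒≢ ab (sym b≡a) }

  neighbour-of-b : ∃[ y ] Later (b , y)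
  neighbour-of-b with y , by , y≢a , _ ← other-neighbour (Link-sym ab) =
    y , by , λ { (inj₁ (a≡b , _)) → Link⇒≢ ab a≡b ; (inj₂ (a≡y , _)) → y≢a (sym a≡y) }

  -- Suppose `uv` is missing. As `H` is free, the copy created by adding it uses the new edge; being
  -- first, this edge is the image of `ab`. Thus `u` is the image of `a` or `b`, and the other cycle
  -- edge at that vertex is mapped to an edge of `H`.
  no-isolated : ∀ {n} (H : EdgeOrderedGraph n) → Saturatedₘ C H → ∀ {u v} → u ≢ v → ∃[ w ] Adj H u w
  no-isolated H (free , creates) {u} {v} u≢v with adj? (edges H) u v
  ... | yes uv = v , uv
  ... | no uv∉H with f , f-inj , C⊑ ← creates u v u≢v uv∉H
    with subst (λ es → map (f ⟨$⟩_) es ⊑ (u , v) ∷ edges H) first C⊑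
  ... | _ ∷ʳ C⊑H =
    ⊥-elim (free (f , f-inj , subst (λ es → map (f ⟨$⟩_) es ⊑ edges H) (sym first) C⊑H))
  ... | inj₁ (refl , _) ∷ rest⊑H with x , ax ← neighbour-of-a = f x , Any-image rest⊑H (later∈rest ax)
  ... | inj₂ (_ , refl) ∷ rest⊑H with y , by ← neighbour-of-b = f y , Any-image rest⊑H (later∈rest by)

  -- By `no-isolated` every vertex appears among the endpoints of the edges; `2 ≤ n` supplies the
  -- second vertex that `no-isolated` asks for.
  n≤2∣E∣ : ∀ {n} → 2 ≤ n → (H : EdgeOrderedGraph n) → Saturatedₘ C H → n ≤ 2 * ∣E H ∣
  n≤2∣E∣ {n} 2≤n H saturated = begin
    n                          ≡⟨ length-allFin n ⟨
    length (allFin n)          ≤⟨ Unique-⊆⇒length≤ (Unique.allFin⁺ n) (λ {u} _ → covered u) ⟩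
    length endpoints           ≡⟨ length-++ (map proj₁ (edges H)) ⟩
    length (map proj₁ (edges H)) + length (map proj₂ (edges H))
      ≡⟨ cong₂ _+_ (length-map proj₁ (edges H)) (length-map proj₂ (edges H)) ⟩
    ∣E H ∣ + ∣E H ∣            ≡⟨ cong (∣E H ∣ +_) (ℕ.+-identityʳ ∣E H ∣) ⟨
    2 * ∣E H ∣                 ∎
    where
    open ℕ.≤-Reasoning

    endpoints : List (Fin n)
    endpoints = map proj₁ (edges H) ++ map proj₂ (edges H)

    another : ∀ {n} → 2 ≤ n → (u : Fin n) → ∃[ v ] u ≢ v
    another (s≤s (s≤s _)) zero    = suc zero , λ ()
    another (s≤s (s≤s _)) (suc u) = zero , λ ()

    endpoint : ∀ {u w} → Adj H u w → ∃[ e ] e ∈ edges H × (u ≡ proj₁ e ⊎ u ≡ proj₂ e)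
    endpoint uw with e , e∈H , uw≈e ← find uw = e , e∈H , Sum.map proj₁ proj₁ uw≈e

    covered : ∀ u → u ∈ endpoints
    covered u with v , u≢v ← another 2≤n u
      with w , uw ← no-isolated H saturated u≢v
      with endpoint uw
    ... | e , e∈H , inj₁ refl = ∈-++⁺ˡ (∈-map⁺ proj₁ e∈H)
    ... | e , e∈H , inj₂ refl = ∈-++⁺ʳ (map proj₁ (edges H)) (∈-map⁺ proj₂ e∈H)

  -- The upper bound

  -- The contraction of `ab`, kept inside `Fin k`: its image misses `b`, which later feeds
  -- `collision`.
  merge : Fin k → Fin k
  merge i with i ≟ b
  ... | yes _ = a
  ... | no  _ = i

  merge-b : merge b ≡ a
  merge-b with b ≟ b
  ... | yes _  = refl
  ... | no b≢b = contradiction refl b≢b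

  merge-fixed : ∀ {i} → i ≢ b → merge i ≡ i
  merge-fixed {i} i≢b with i ≟ b
  ... | yes i≡b = contradiction i≡b i≢b
  ... | no  _   = refl

  merge≡a : ∀ i → merge i ≡ a → i ≡ a ⊎ i ≡ b
  merge≡a i eq with i ≟ b
  ... | yes i≡b = inj₂ i≡b
  ... | no  _   = inj₁ eq

  merge≢b : ∀ i → merge i ≢ b
  merge≢b i eq with i ≟ b
  ... | yes _  = Link⇒≢ ab eq
  ... | no i≢b = i≢b eq

  merge-injective : ∀ i j → merge i ≡ merge j → merge i ≢ a → i ≡ j
  merge-injective i j eq ≢a with i ≟ b | j ≟ b
  ... | yes _ | _     = contradiction refl ≢a
  ... | no  _ | yes _ = contradiction eq ≢a
  ... | no  _ | no  _ = eq

  -- The possible neighbours of the merged vertex: the other neighbour of `a` and the other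
  -- neighbour of `b` on the cycle. The condition `c ≢ a` is recorded because `retract` is injective
  -- only outside the class of `a`.
  AtMerged : Fin k → Set
  AtMerged c = c ≢ a × (c ≡ proj₁ (other-neighbour ab) ⊎ c ≡ proj₁ (other-neighbour (Link-sym ab)))

  neighbour-of-merged : ∀ {u v} → Later (u , v) → merge u ≡ a → AtMerged (merge v)
  neighbour-of-merged {u} {v} (uv , ab≉uv) mu≡a with merge≡a u mu≡a
  ... | inj₁ refl = (λ mv≡a → [ Link⇒≢ uv ∘ sym , v≢b ]′ (merge≡a v mv≡a)) ,
                    inj₁ (trans (merge-fixed v≢b)
                                (proj₂ (proj₂ (proj₂ (other-neighbour ab))) v uv v≢b))
    where
    v≢b : v ≢ b
    v≢b refl = ab≉uv ≈ₑ-refl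
  ... | inj₂ refl = (λ mv≡a → [ v≢a , Link⇒≢ uv ∘ sym ]′ (merge≡a v mv≡a)) ,
                    inj₂ (trans (merge-fixed (Link⇒≢ uv ∘ sym))
                                (proj₂ (proj₂ (proj₂ (other-neighbour (Link-sym ab)))) v uv v≢a))
    where
    v≢a : v ≢ a
    v≢a refl = ab≉uv (inj₂ (refl , refl))

  merge-loopless : ∀ {u v} → Later (u , v) → merge u ≢ merge v
  merge-loopless {u} {v} uv eq with merge u ≟ a
  ... | yes mu≡a = proj₁ (neighbour-of-merged uv mu≡a) (trans (sym eq) mu≡a)
  ... | no  mu≢a = Link⇒≢ (proj₁ uv) (merge-injective u v eq mu≢a)

  -- Two edges could be identified only if they joined `a` and `b` to a common vertex, and that
  -- vertex would form a triangle with `ab`.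
  merge-reflects : ∀ {u v u′ v′} → Later (u , v) → Later (u′ , v′) →
                   merge u ≡ merge u′ → merge v ≡ merge v′ → u ≡ u′
  merge-reflects {u} {v} {u′} {v′} uv u′v′ equ eqv with merge u ≟ a
  ... | no  mu≢a = merge-injective u u′ equ mu≢a
  ... | yes mu≡a with merge-injective v v′ eqv (proj₁ (neighbour-of-merged uv mu≡a))
  ... | refl with merge≡a u mu≡a | merge≡a u′ (trans (sym equ) mu≡a)
  ... | inj₁ refl | inj₁ refl = refl
  ... | inj₂ refl | inj₂ refl = refl
  ... | inj₁ refl | inj₂ refl = ⊥-elim (triangle-free (proj₁ uv) (Link-sym (proj₁ u′v′)) ab)
  ... | inj₂ refl | inj₁ refl = ⊥-elim (triangle-free (proj₁ u′v′) (Link-sym (proj₁ uv)) ab)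

  merge-simple : ∀ {e e′} → Later e → Later e′ → ¬ e ≈ₑ e′ → ¬ merge ⟨$⟩ e ≈ₑ merge ⟨$⟩ e′
  merge-simple uv u′v′ e≉e′ (inj₁ (p , q)) = e≉e′
    (inj₁ (merge-reflects uv u′v′ p q , merge-reflects (Later-swap uv) (Later-swap u′v′) q p))
  merge-simple uv u′v′ e≉e′ (inj₂ (p , q)) = e≉e′
    (inj₂ (merge-reflects uv (Later-swap u′v′) p q , merge-reflects (Later-swap uv) u′v′ q p))

  quotient : EdgeOrderedGraph k
  quotient = record
    { edges    = map (merge ⟨$⟩_) rest
    ; loopless = All.map⁺ (All.map merge-loopless rest-later)
    ; simple   = AllPairs.map⁺ (AllPairs-mapWith merge-simple rest-later (AllPairs.tail rest-simple))
    }

  neighbour-in-quotient : ∀ {c} → Adj quotient a c → AtMerged c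
  neighbour-in-quotient ac with uv , ac≈muv ← All.lookupAny rest-later (Any.map⁻ ac) = via uv ac≈muv
    where
    via : ∀ {e c} → Later e → (a , c) ≈ₑ merge ⟨$⟩ e → AtMerged c
    via uv (inj₁ (a≡mu , refl)) = neighbour-of-merged uv (sym a≡mu)
    via uv (inj₂ (a≡mv , refl)) = neighbour-of-merged (Later-swap uv) (sym a≡mv)

  -- The blow-up of the contracted cycle and its completion

  module _ (m : ℕ) where

    -- The class of a consists of the m additional vertices and of the copies of a and b themselves.
    retract : Fin (k + m) → Fin k
    retract s = [ merge , const a ]′ (splitAt k s)

    retract-↑ˡ : ∀ i → retract (i ↑ˡ m) ≡ merge i
    retract-↑ˡ i = cong [ merge , const a ]′ (splitAt-↑ˡ k i m)

    retract-↑ʳ : ∀ s → retract (k ↑ʳ s) ≡ a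
    retract-↑ʳ s = cong [ merge , const a ]′ (splitAt-↑ʳ k m s)

    retract≢b : ∀ s → retract s ≢ b
    retract≢b s eq with splitAt k s
    ... | inj₁ i = merge≢b i eq
    ... | inj₂ _ = Link⇒≢ ab eq

    retract-injective : ∀ s t → retract s ≡ retract t → retract s ≢ a → s ≡ t
    retract-injective s t eq ≢a with splitAt k s in eqs | splitAt k t in eqt
    ... | inj₂ _ | _      = contradiction refl ≢a
    ... | inj₁ _ | inj₂ _ = contradiction eq ≢a
    ... | inj₁ i | inj₁ j =
      trans (sym (splitAt⁻¹-↑ˡ eqs))
            (trans (cong (_↑ˡ m) (merge-injective i j eq ≢a)) (splitAt⁻¹-↑ˡ eqt))

    base : EdgeOrderedGraph (k + m)
    base = blowUp retract quotient

    -- The classes miss `b`, so two vertices `i` and `j` of the copy share a class. It is the class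
    -- of `a`, as any other class has at most one vertex. The neighbours of `i` and `j` then lie in
    -- the two classes of `AtMerged`, each with at most one vertex, which `no-common-neighbourhood`
    -- excludes.
    base-free : Free C base
    base-free (f , f-inj , C⊑base)
      with i , j , i≢j , eq ← collision (retract ∘ f) b (retract≢b ∘ f) =
      no-common-neighbourhood h _ _ i≢j (proj₂ ∘ around)
        (λ {p} {p′} P _ hp≡hp′ → f-inj (retract-injective (f p) (f p′) hp≡hp′ (proj₁ (around P))))
      where
      h : Fin k → Fin k
      h = retract ∘ f

      hi≡a : h i ≡ a
      hi≡a = decidable-stable (h i ≟ a) λ hi≢a → i≢j (f-inj (retract-injective (f i) (f j) eq hi≢a))

      hom : ∀ {p q} → Link p q → Adj quotient (h p) (h q)
      hom pq = Adj-blowUp⁻ retract quotient (Any-image C⊑base (Link⇒Adj pq))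

      around : ∀ {p} → Around i j p → AtMerged (h p)
      around {p} (inj₁ ip) = neighbour-in-quotient (subst (λ c → Adj quotient c (h p)) hi≡a (hom ip))
      around {p} (inj₂ jp) =
        neighbour-in-quotient (subst (λ c → Adj quotient c (h p)) (trans (sym eq) hi≡a) (hom jp))

    new-nonadjacent : ∀ s t → ¬ Adj base (k ↑ʳ s) (k ↑ʳ t)
    new-nonadjacent s t st = Adj⇒≢ quotient (Adj-blowUp⁻ retract quotient st)
                                   (trans (retract-↑ʳ s) (sym (retract-↑ʳ t)))

    -- The new edge plays `ab`, and every other vertex of `C` goes to its own copy. Since `retract`
    -- after `place` is `merge`, the images of `rest` fall into the successive blocks of `base`.
    new-copy : ∀ {s t} → s ≢ t → Embeds ((k ↑ʳ s , k ↑ʳ t) ∷ edges base) C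
    new-copy {s} {t} s≢t = place , place-injective ,
      subst (λ es → map (place ⟨$⟩_) es ⊑ (k ↑ʳ s , k ↑ʳ t) ∷ edges base) (sym first)
        (inj₁ (place-a , place-b) ∷
         subst (λ es → map (place ⟨$⟩_) rest ⊑ concat (map (block retract) es)) images
           (⊑-blowUp retract (map (place ⟨$⟩_) rest)))
      where
      place : Fin k → Fin (k + m)
      place i with i ≟ a | i ≟ b
      ... | yes _ | _     = k ↑ʳ s
      ... | no  _ | yes _ = k ↑ʳ t
      ... | no  _ | no  _ = i ↑ˡ m

      place-a : place a ≡ k ↑ʳ s
      place-a with a ≟ a
      ... | yes _  = refl
      ... | no a≢a = contradiction refl a≢a

      place-b : place b ≡ k ↑ʳ t
      place-b with b ≟ a | b ≟ b
      ... | yes b≡a | _      = contradiction (sym b≡a) (Link⇒≢ ab)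
      ... | no  _   | yes _  = refl
      ... | no  _   | no b≢b = contradiction refl b≢b

      place-other : ∀ {i} → i ≢ a → i ≢ b → place i ≡ i ↑ˡ m
      place-other {i} i≢a i≢b with i ≟ a | i ≟ b
      ... | yes i≡a | _       = contradiction i≡a i≢a
      ... | no  _   | yes i≡b = contradiction i≡b i≢b
      ... | no  _   | no  _   = refl

      retract-place : ∀ i → retract (place i) ≡ merge i
      retract-place i = by-cases (i ≟ a) (i ≟ b)
        where
        by-cases : Dec (i ≡ a) → Dec (i ≡ b) → retract (place i) ≡ merge i
        by-cases (yes refl) _          =
          trans (cong retract place-a) (trans (retract-↑ʳ s) (sym (merge-fixed (Link⇒≢ ab))))
        by-cases (no _)     (yes refl) =
          trans (cong retract place-b) (trans (retract-↑ʳ t) (sym merge-b))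
        by-cases (no i≢a)   (no i≢b)   =
          trans (cong retract (place-other i≢a i≢b)) (retract-↑ˡ i)

      place-a≢b : place a ≢ place b
      place-a≢b eq = s≢t (↑ʳ-injective k s t (trans (sym place-a) (trans eq place-b)))

      -- Equal places give equal values of `merge`, which identifies only `a` with `b`; these two
      -- are placed at distinct vertices.
      place-injective : Injective _≡_ _≡_ place
      place-injective {i} {j} eq = by-cases (merge i ≟ a)
        where
        merges : merge i ≡ merge j
        merges = trans (sym (retract-place i)) (trans (cong retract eq) (retract-place j))

        by-cases : Dec (merge i ≡ a) → i ≡ j
        by-cases (no  mi≢a) = merge-injective i j merges mi≢a
        by-cases (yes mi≡a) with merge≡a i mi≡a | merge≡a j (trans (sym merges) mi≡a)
        ... | inj₁ refl | inj₁ refl = refl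
        ... | inj₂ refl | inj₂ refl = refl
        ... | inj₁ refl | inj₂ refl = contradiction eq place-a≢b
        ... | inj₂ refl | inj₁ refl = contradiction (sym eq) place-a≢b

      images : map (retract ⟨$⟩_) (map (place ⟨$⟩_) rest) ≡ map (merge ⟨$⟩_) rest
      images = trans (sym (map-∘ rest))
        (map-cong (λ (u , v) → cong₂ _,_ (retract-place u) (retract-place v)) rest)

    -- By `completion-skips` no edge of `H` joins two of the `m` additional vertices, so each listed
    -- pair has its first or its second entry among the `k` core vertices; hence the two products.
    sparse-saturated : ∃[ H ] Saturatedₘ {n = k + m} C H × ∣E H ∣ ≤ (k + k) * (k + m)
    sparse-saturated with H , saturated , new , eq ← completion C base base-free =
      H , saturated , (begin
        ∣E H ∣                        ≤⟨ Unique-⊆⇒length≤ (edges-unique H) covered ⟩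
        length (core×all ++ all×core) ≡⟨ length-++ core×all ⟩
        length core×all + length all×core
          ≡⟨ cong₂ _+_ (length-cartesianProduct core (allFin n))
                       (length-cartesianProduct (allFin n) core) ⟩
        length core * length (allFin n) + length (allFin n) * length core
          ≡⟨ cong₂ (λ x y → x * y + y * x) length-core (length-allFin n) ⟩
        k * n + n * k                 ≡⟨ cong (k * n +_) (ℕ.*-comm n k) ⟩
        k * n + k * n                 ≡⟨ ℕ.*-distribʳ-+ n k k ⟨
        (k + k) * n                   ∎)
      where
      open ℕ.≤-Reasoning

      n : ℕ
      n = k + m

      core : List (Fin n)
      core = map (_↑ˡ m) (allFin k)

      core×all all×core : List (Pair n)
      core×all = cartesianProduct core (allFin n)
      all×core = cartesianProduct (allFin n) core

      length-core : length core ≡ k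
      length-core = trans (length-map (_↑ˡ m) (allFin k)) (length-allFin k)

      covered : ∀ {e} → e ∈ edges H → e ∈ core×all ++ all×core
      covered {s , t} e∈H with splitAt k s in eqs | splitAt k t in eqt
      ... | inj₁ i | _ rewrite sym (splitAt⁻¹-↑ˡ eqs) =
        ∈-++⁺ˡ (∈-cartesianProduct⁺ (∈-map⁺ (_↑ˡ m) (∈-allFin i)) (∈-allFin t))
      ... | inj₂ _ | inj₁ j rewrite sym (splitAt⁻¹-↑ˡ eqt) =
        ∈-++⁺ʳ core×all (∈-cartesianProduct⁺ (∈-allFin s) (∈-map⁺ (_↑ˡ m) (∈-allFin j)))
      ... | inj₂ s′ | inj₂ t′ with refl ← splitAt⁻¹-↑ʳ {k} eqs | refl ← splitAt⁻¹-↑ʳ {k} eqt =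
        contradiction (∈⇒Adj H e∈H)
          (completion-skips {G = C} base H (proj₁ saturated) eq (new-nonadjacent s′ t′)
            (new-copy λ { refl → Adj⇒≢ H (∈⇒Adj H e∈H) refl }))

  -- The minimum and its order of growth

  empty : ∀ n → EdgeOrderedGraph n
  empty n = record { edges = [] ; loopless = [] ; simple = [] }

  empty-free : ∀ n → Free C (empty n)
  empty-free n (f , _ , C⊑[]) with subst (λ es → map (f ⟨$⟩_) es ⊑ []) first C⊑[]
  ... | ()

  -- A value is required for every `n`, also below `k`, where there is no blow-up; completing the
  -- empty graph gives a saturated graph for all `n`.
  minimum-saturated : ∀ n → ∃[ s ] IsSatₘ n C s
  minimum-saturated n
    with H , saturated , _ ← completion C (empty n) (empty-free n)
    with s , attained , minimal ← least (saturated-of-size? n C) (H , saturated , refl) =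
    s , attained , λ H′ saturated′ → minimal ∣E H′ ∣ (H′ , saturated′ , refl)

  sat : ℕ → ℕ
  sat n = proj₁ (minimum-saturated n)

  sat-lower : ∀ {n} → 2 ≤ n → n ≤ 2 * sat n
  sat-lower {n} 2≤n with (H , saturated , size) , _ ← proj₂ (minimum-saturated n) =
    subst (λ s → n ≤ 2 * s) size (n≤2∣E∣ 2≤n H saturated)

  sat-upper : ∀ m → sat (k + m) ≤ (k + k) * (k + m)
  sat-upper m with H , saturated , sparse ← sparse-saturated m =
    ℕ.≤-trans (proj₂ (proj₂ (minimum-saturated (k + m))) H saturated) sparse

  sat=Θn : sat =Θ (λ n → n)
  -- The 2 counts the endpoints of an edge, and `k + k` comes from the two products with the core.
  -- The threshold `k` ensures both `2 ≤ n` and `n ≡ k + m` for some `m`.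
  sat=Θn = 2 , k + k , k , bounds
    where
    bounds : ∀ n → k ≤ n → n ≤ 2 * sat n × sat n ≤ (k + k) * n
    bounds n k≤n with m , refl ← ℕ.m≤n⇒∃[o]m+o≡n k≤n =
      sat-lower (ℕ.≤-trans (ℕ.≤-trans (s≤s (s≤s z≤n)) 5≤k) k≤n) , sat-upper m

claim30 : ∀ (k : ℕ) → 5 ≤ k → (C : EdgeOrderedGraph k) → IsCycle C →
    ∃[ sat ] (∀ n → IsSatₘ n C (sat n)) × sat =Θ (λ n → n)
claim30 (suc k) 5≤k C isCycle = sat , (λ n → proj₂ (minimum-saturated n)) , sat=Θn
  where
  nonempty : ∀ {A : Set} {P : A → Set} {xs : List A} → Any P xs → ∃[ x ] ∃[ xs′ ] xs ≡ x ∷ xs′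
  nonempty {xs = x ∷ xs′} _ = x , xs′ , refl

  -- The arc leaving vertex `zero` shows that `C` has an edge, so its edge list has a head to serve
  -- as `ab`.
  first-edge : ∃[ e ] ∃[ rest ] edges C ≡ e ∷ rest
  first-edge with j , CyclicOrder.arc next ← CyclicOrder.successor 5≤k zero =
    nonempty (Equivalence.from (isCycle zero j) (inj₁ next))

  open Cycle 5≤k C isCycle (proj₂ (proj₂ first-edge))
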